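{- Let $G$ and $H$ be simple connected graphs, each with at least two vertices. Then the Cartesian product $G \Box H$ and the strong product $G \boxtimes H$ are not isomorphic.
   Context: All graphs are finite, undirected and simple (no loops or multiple edges). For graphs $G$ and $H$, the following products have vertex set $V(G)\times V(H)$. The Cartesian product $G \Box H$: $(x,y)\sim(x',y')$ if either ($x\sim x'$ in $G$ and $y=y'$) or ($x=x'$ and $y\sim y'$ in $H$). The strong product $G\boxtimes H$: $(x,y)\sim(x',y')$ if either ($x\sim x'$ in $G$ and $y=y'$) or ($x=x'$ and $y\sim y'$ in $H$) or ($x\sim x'$ in $G$ and $y\sim y'$ in $H$). Two graphs are isomorphic if there is a bijection between their vertex sets that preserves adjacency and non-adjacency. -}

module Defs where

open import Data.Fin.Base using (Fin)
open import Data.Fin.Properties using (*↔×) renaming (_≟_ to _≟ᶠ_)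
open import Data.Nat.Base using (ℕ; _*_)
open import Data.Product.Base using (_×_; _,_)
open import Data.Product.Function.NonDependent.Propositional using (_×-↔_)
open import Data.Sum.Base using (_⊎_; inj₁; inj₂)
open import Function.Bundles using (_↔_; _⤖_; _⇔_; module Bijection)
open import Function.Construct.Composition using (_↔-∘_)
open import Function.Construct.Symmetry using (↔-sym)
open import Function.Properties.Inverse using (↔⇒↣)
open import Relation.Binary.Core using (Rel)
open import Relation.Binary.Construct.Closure.ReflexiveTransitive using (Star)
open import Relation.Binary.Definitions using (Decidable; DecidableEquality; Irreflexive; Symmetric)
open import Relation.Binary.PropositionalEquality using (_≡_; refl; sym)
open import Relation.Nullary.Decidable using (_×-dec_; _⊎-dec_; via-injection)
open import Level using (0ℓ)

-- Adjacency is only ever used up to logical equivalence, so distinct proofs of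
-- Adj x y do not count as multiple edges. Decidability of Adj is automatic
-- classically.
record Graph : Set₁ where
  field
    Vertex : Set
    order  : ℕ
    finite : Vertex ↔ Fin order
    Adj    : Rel Vertex 0ℓ
    adj?   : Decidable Adj
    adj-sym    : Symmetric Adj
    adj-irrefl : Irreflexive _≡_ Adj

  _≟_ : DecidableEquality Vertex
  _≟_ = via-injection (↔⇒↣ finite) _≟ᶠ_

open Graph using (Vertex; order; Adj)

Connected : Graph → Set
Connected G = (x y : Vertex G) → Star (Adj G) x y

infix 4 _≅_

record _≅_ (G H : Graph) : Set where
  field
    bijection : Vertex G ⤖ Vertex H

  open Bijection bijection public using (to)

  field
    adj⇔ : ∀ x y → Adj G x y ⇔ Adj H (to x) (to y)

module _ (G H : Graph) where
  private
    module G = Graph G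
    module H = Graph H

  CartesianAdj : Rel (Vertex G × Vertex H) 0ℓ
  CartesianAdj (x , y) (x′ , y′) =
    (Adj G x x′ × y ≡ y′) ⊎ (x ≡ x′ × Adj H y y′)

  StrongAdj : Rel (Vertex G × Vertex H) 0ℓ
  StrongAdj (x , y) (x′ , y′) =
    (Adj G x x′ × y ≡ y′) ⊎ (x ≡ x′ × Adj H y y′) ⊎ (Adj G x x′ × Adj H y y′)

  private
    finite-× : (Vertex G × Vertex H) ↔ Fin (order G * order H)
    finite-× = ↔-sym *↔× ↔-∘ (G.finite ×-↔ H.finite)

  infixr 6 _□_ _⊠_

  _□_ : Graph
  _□_ = record
    { Vertex = Vertex G × Vertex H
    ; order  = order G * order H
    ; finite = finite-×
    ; Adj    = CartesianAdj
    ; adj?   = λ (x , y) (x′ , y′) →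
        (G.adj? x x′ ×-dec y H.≟ y′) ⊎-dec (x G.≟ x′ ×-dec H.adj? y y′)
    ; adj-sym = λ where
        (inj₁ (a , e)) → inj₁ (G.adj-sym a , sym e)
        (inj₂ (e , b)) → inj₂ (sym e , H.adj-sym b)
    ; adj-irrefl = λ where
        refl (inj₁ (a , _)) → G.adj-irrefl refl a
        refl (inj₂ (_ , b)) → H.adj-irrefl refl b
    }

  _⊠_ : Graph
  _⊠_ = record
    { Vertex = Vertex G × Vertex H
    ; order  = order G * order H
    ; finite = finite-×
    ; Adj    = StrongAdj
    ; adj?   = λ (x , y) (x′ , y′) →
        (G.adj? x x′ ×-dec y H.≟ y′)
          ⊎-dec (x G.≟ x′ ×-dec H.adj? y y′)
          ⊎-dec (G.adj? x x′ ×-dec H.adj? y y′)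
    ; adj-sym = λ where
        (inj₁ (a , e))        → inj₁ (G.adj-sym a , sym e)
        (inj₂ (inj₁ (e , b))) → inj₂ (inj₁ (sym e , H.adj-sym b))
        (inj₂ (inj₂ (a , b))) → inj₂ (inj₂ (G.adj-sym a , H.adj-sym b))
    ; adj-irrefl = λ where
        refl (inj₁ (a , _))        → G.adj-irrefl refl a
        refl (inj₂ (inj₁ (_ , b))) → H.adj-irrefl refl b
        refl (inj₂ (inj₂ (a , _))) → G.adj-irrefl refl a
    }

{-# OPTIONS --safe #-}
-- On the common vertex set, every Cartesian edge is a strong edge, and the
-- inclusion is strict: an edge of G and an edge of H span a diagonal strong edge.
-- An isomorphism φ carries Cartesian adjacency onto strong adjacency, so a strong
-- pair φ p comes from a Cartesian, hence strong, pair p. Some positive power φⁿ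
-- fixes the diagonal pair d, so pulling d = φⁿ d back gives that φ d is strong and
-- hence that d is Cartesian, which it is not.
module Submission where

open import Defs
open import Data.Fin.Base using (Fin; zero; suc; toℕ)
open import Data.Fin.Properties using (*↔×; pigeonhole)
open import Data.Nat.Base using (zero; suc; _+_; _*_; _≤_; s≤s; z≤n)
open import Data.Nat.GeneralisedArithmetic using (fold)
open import Data.Nat.Properties using (n<1+n; m≤n⇒∃[o]m+o≡n; +-suc)
open import Data.Product.Base using (_×_; _,_; ∃; ∃₂)
open import Data.Product.Function.NonDependent.Propositional using (_×-↔_; _×-↣_)
open import Data.Sum.Base using (inj₁; inj₂)
open import Function.Base using (_∘_)
open import Function.Bundles using (_↔_; _↣_; module Bijection; module Equivalence; module Injection)
open import Function.Construct.Composition using (_↔-∘_)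
open import Function.Construct.Symmetry using (↔-sym)
open import Function.Properties.Inverse using (↔⇒↣)
open import Relation.Binary.Construct.Closure.ReflexiveTransitive using (ε; _◅_)
open import Relation.Binary.PropositionalEquality using (_≡_; _≢_; refl; sym; trans; cong; subst)
open import Relation.Nullary.Negation.Core using (¬_; contradiction)

open Graph using (Vertex; order; Adj; finite; adj-irrefl)

module _ {A : Set} (f↣ : A ↣ A) where
  open Injection f↣ using (injective) renaming (to to f)

  -- Both sides unfold to an outermost `f` when `i` is a successor, so injectivity strips one
  -- application at a time.
  fold-cancel : ∀ x i {m} → fold x f i ≡ fold x f (i + m) → x ≡ fold x f m
  fold-cancel x zero    eq = eq
  fold-cancel x (suc i) eq = fold-cancel x i (injective eq)

  -- Two of the first `n + 1` iterates of `x` collide; cancelling the shorter one returns to `x`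
  -- itself.
  injection-periodic : ∀ {n} → A ↔ Fin n → ∀ x → ∃ λ k → x ≡ fold x f (suc k)
  injection-periodic {n} A↔Fin x
    with i , j , i<j , eq ← pigeonhole (n<1+n n) (λ i → Injection.to (↔⇒↣ A↔Fin) (fold x f (toℕ i)))
    -- Since `i<j` unfolds to `suc (toℕ i) ≤ toℕ j`, the gap between the exponents is `suc k`, hence
    -- positive.
    with k , i+k≡j ← m≤n⇒∃[o]m+o≡n i<j
    = k , fold-cancel x (toℕ i)
        (trans (Injection.injective (↔⇒↣ A↔Fin) eq)
               (cong (fold x f) (trans (sym i+k≡j) (sym (+-suc (toℕ i) k)))))

  module _ (P : A → Set) (pull : ∀ {a} → P (f a) → P a) where

    -- The descent stops with one `f` left, so that on a periodic orbit it ends one step ahead of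
    -- its start.
    fold-pullback : ∀ {a} k → P (fold a f (suc k)) → P (f a)
    fold-pullback zero    p = p
    fold-pullback (suc k) p = fold-pullback k (pull p)

    pullback⇒preserved : ∀ {n} → A ↔ Fin n → ∀ {a} → P a → P (f a)
    pullback⇒preserved A↔Fin {a} p with k , eq ← injection-periodic A↔Fin a =
      fold-pullback k (subst P eq p)

distinct-pair : ∀ {A : Set} {n} → A ↔ Fin n → 2 ≤ n → ∃₂ λ (x y : A) → x ≢ y
distinct-pair A↔Fin (s≤s (s≤s z≤n)) =
  from zero , from (suc zero) , λ eq → contradiction (injective eq) λ ()
  where open Injection (↔⇒↣ (↔-sym A↔Fin)) renaming (to to from)

-- A walk between distinct vertices is nonempty, and its first step is an edge.
connected⇒edge : ∀ G → Connected G → 2 ≤ order G → ∃₂ (Adj G)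
connected⇒edge G connected 2≤n
  with x , y , x≢y ← distinct-pair (finite G) 2≤n
  with connected x y
... | ε     = contradiction refl x≢y
... | a ◅ _ = _ , _ , a

Cartesian⇒Strong : ∀ G H {p q} → CartesianAdj G H p q → StrongAdj G H p q
Cartesian⇒Strong G H (inj₁ a) = inj₁ a
Cartesian⇒Strong G H (inj₂ b) = inj₂ (inj₁ b)

diagonal-not-Cartesian : ∀ G H {x x′ y y′} → Adj G x x′ → Adj H y y′ →
  ¬ CartesianAdj G H (x , y) (x′ , y′)
diagonal-not-Cartesian G H a b (inj₁ (_ , y≡y′)) = adj-irrefl H y≡y′ b
diagonal-not-Cartesian G H a b (inj₂ (x≡x′ , _)) = adj-irrefl G x≡x′ a

theorem3p4 : (G H : Graph) → Connected G → Connected H →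
    2 ≤ Graph.order G → 2 ≤ Graph.order H →
    ¬ ((G □ H) ≅ (G ⊠ H))
theorem3p4 G H connG connH 2≤G 2≤H iso
  with x , x′ , a ← connected⇒edge G connG 2≤G
  with y , y′ , b ← connected⇒edge H connH 2≤H
  = diagonal-not-Cartesian G H a b
      -- Adjacency is a predicate on pairs, so periodicity is applied to `φ` acting on both
      -- coordinates: one exponent then fixes both endpoints.
      (reflect (pullback⇒preserved (φ ×-↣ φ) Strong (Cartesian⇒Strong G H ∘ reflect)
                  pairs-finite (inj₂ (inj₂ (a , b)))))
  where
  V = Vertex G × Vertex H

  φ : V ↣ V
  φ = Bijection.injection (_≅_.bijection iso)

  Strong : V × V → Set
  Strong (p , q) = StrongAdj G H p q

  reflect : ∀ {p q} → StrongAdj G H (_≅_.to iso p) (_≅_.to iso q) → CartesianAdj G H p q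
  reflect {p} {q} = Equivalence.from (_≅_.adj⇔ iso p q)

  pairs-finite : (V × V) ↔ Fin (order (G □ H) * order (G □ H))
  pairs-finite = ↔-sym *↔× ↔-∘ (finite (G □ H) ×-↔ finite (G □ H))
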